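{- Let $p$ be a prime number, let $u \geqslant 1$ and $n \geqslant m \geqslant 1$ be integers, and let $$f(x) = a_{n}x^{n} + a_{n-1}x^{n-1} + \cdots + a_{m}x^{m} + p^{u} \in \mathbb{Z}[x]$$ with $a_n \neq 0$. Suppose that $p \nmid a_{m}$, that $\gcd(u, m) = 1$, and that $$p^{u} > |a_{n}| + |a_{n-1}| + \cdots + |a_{m}|.$$ Then $f(x)$ is irreducible over $\mathbb{Q}$. -}

module Defs where

open import Algebra.Bundles using (RawSemiring)
import Algebra.Definitions.RawSemiring as RawSemiringDefs
open import Data.Integer.Base as ℤ using (ℤ; +_)
open import Data.List.Base using (List; []; _∷_; [_]; _++_; foldr; map; replicate; upTo)
open import Data.Nat.Base as ℕ using (ℕ; zero; suc; _∸_; _^_)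
open import Data.Rational.Base as ℚ using (ℚ)

-- R[x]: a polynomial is the list of its coefficients, constant term first.
-- Trailing zeros are allowed, so equality is equality of all coefficients.
module Polynomial {c ℓ} (R : RawSemiring c ℓ) where

  open RawSemiring R

  Poly : Set c
  Poly = List Carrier

  coeff : Poly → ℕ → Carrier
  coeff []      _       = 0#
  coeff (a ∷ f) zero    = a
  coeff (a ∷ f) (suc i) = coeff f i

  infix  4 _≈ₚ_
  infixl 6 _+ₚ_
  infixl 7 _*ₚ_

  _≈ₚ_ : Poly → Poly → Set ℓ
  f ≈ₚ g = ∀ i → coeff f i ≈ coeff g i

  _+ₚ_ : Poly → Poly → Poly
  []      +ₚ g       = g
  (a ∷ f) +ₚ []      = a ∷ f
  (a ∷ f) +ₚ (b ∷ g) = (a + b) ∷ (f +ₚ g)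

  -- (a + x f) g = a g + x (f g)
  _*ₚ_ : Poly → Poly → Poly
  []      *ₚ g = []
  (a ∷ f) *ₚ g = map (a *_) g +ₚ (0# ∷ (f *ₚ g))

  constant : Carrier → Poly
  constant a = [ a ]

  -- a xⁱ
  monomial : Carrier → ℕ → Poly
  monomial a i = replicate i 0# ++ [ a ]

  sumₚ : List Poly → Poly
  sumₚ = foldr _+ₚ_ []

  polyRawSemiring : RawSemiring c ℓ
  polyRawSemiring = record
    { Carrier = Poly
    ; _≈_     = _≈ₚ_
    ; _+_     = _+ₚ_
    ; _*_     = _*ₚ_
    ; 0#      = []
    ; 1#      = constant 1#
    }

module ℤ[x] = Polynomial ℤ.+-*-rawSemiring
module ℚ[x] = Polynomial ℚ.+-*-rawSemiring

toℚ[x] : ℤ[x].Poly → ℚ[x].Poly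
toℚ[x] = map (λ a → a ℚ./ 1)

IrreducibleOverℚ : ℤ[x].Poly → Set
IrreducibleOverℚ f =
  RawSemiringDefs.Irreducible ℚ[x].polyRawSemiring (toℚ[x] f)

-- The list m, m + 1, …, n (for m ≤ n).
range : ℕ → ℕ → List ℕ
range m n = map (m ℕ.+_) (upTo (suc n ∸ m))

-- aₙ xⁿ + ⋯ + aₘ xᵐ + pᵘ
poly : (p u n m : ℕ) → (ℕ → ℤ) → ℤ[x].Poly
poly p u n m a =
  sumₚ (map (λ i → monomial (a i) i) (range m n)) +ₚ constant (+ (p ^ u))
  where open ℤ[x]

{-# OPTIONS --safe #-}

-- Clear denominators and use Gauss' lemma to reduce to a factorisation f = g h
-- over ℤ; then |g(0)| |h(0)| = pᵘ, so |g(0)| = p^α and |h(0)| = p^β with α + β = u.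
-- If β = 0, then h(0) = ±1, so 1/h is a power series with integer coefficients, and
-- f · (1/h) = g is a polynomial. Because pᵘ exceeds the sum of the other |aᵢ|, the
-- resulting recurrence makes the coefficients of 1/h shrink, and being integers they
-- are eventually 0: h is invertible in ℤ[x]. This replaces the classical argument on the
-- absolute values of complex roots. The case α = 0 is symmetric.
-- If α, β ≥ 1, let w(g) be the minimum of m v_p(bᵢ) + u i over the coefficients bᵢ of g;
-- w is additive on products and w(f) = m u. As p ∤ aₘ, there are i + j = m such that p
-- divides neither bᵢ nor cⱼ, whence w(g) = m α = u i and w(h) = m β = u j. Since
-- gcd(u, m) = 1, m ∣ i, so i or j vanishes, contradicting α, β ≥ 1. (The Newton polygon
-- of f has the slope -u/m in lowest terms.) Gauss' lemma is also an instance of the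
-- additivity of w, for the weights v_q(bᵢ).
module Submission where

open import Defs
open import Algebra.Bundles using (CommutativeRing; CommutativeSemiring)
open import Algebra.Definitions.RawMagma using () renaming (_,_ to infixr 4 _∣ʳ,_)
import Algebra.Definitions.RawSemiring as RawSemiringDefs
import Algebra.Properties.AbelianGroup as AbelianGroupProperties
import Algebra.Properties.CommutativeSemigroup as CommutativeSemigroupProperties
open import Data.Empty using (⊥; ⊥-elim)
open import Data.Integer.Base as ℤ using (ℤ; +_; 0ℤ; 1ℤ; ∣_∣)
open import Data.Integer.Divisibility using (_∣_)
import Data.Integer.Divisibility.Signed as Signed
import Data.Integer.Properties as ℤₚ
open import Data.List.Base using (List; []; _∷_; map; applyUpTo; length)
open import Data.List.Membership.Propositional using (_∈_; _∉_)
open import Data.List.Membership.Propositional.Properties using (∈-map⁺; ∈-map⁻; ∈-upTo⁺; ∈-upTo⁻)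
open import Data.List.Relation.Unary.All as All using (All; []; _∷_)
open import Data.List.Relation.Unary.AllPairs using (_∷_)
open import Data.List.Relation.Unary.Any using (here; there)
open import Data.List.Relation.Unary.Unique.Propositional using (Unique)
import Data.List.Relation.Unary.Unique.Propositional.Properties as Unique
open import Data.Nat.Base using (ℕ; zero; suc)
open import Data.Nat.Coprimality as Coprimality using (coprime-divisor; gcd≡1⇒coprime)
import Data.Nat.Divisibility as ℕ∣
open import Data.Nat.GCD using (gcd)
open import Data.Nat.ListAction using (sum; product)
open import Data.Nat.Primality using (Prime; euclidsLemma; prime⇒nonZero; prime⇒nonTrivial)
open import Data.Nat.Primality.Factorisation using (factorise; module PrimeFactorisation)
open import Data.Nat.Solver using (module +-*-Solver)
open import Data.Product.Base using (∃; ∃₂; _×_; _,_; proj₁; proj₂)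
open import Data.Rational.Base as ℚ using (ℚ; 1ℚ; 1/_; ↥_; ↧_; ↧ₙ_; toℚᵘ)
import Data.Rational.Properties as ℚₚ
open import Data.Rational.Unnormalised.Base as ℚᵘ using (mkℚᵘ; *≡*)
import Data.Rational.Unnormalised.Properties as ℚᵘₚ
open import Data.Sum.Base as Sum using (_⊎_; inj₁; inj₂; [_,_]′)
open import Function.Base using (_∘_; _$_)
open import Relation.Binary.Definitions using (tri<; tri≈; tri>)
import Relation.Binary.Reasoning.Setoid as SetoidReasoning
open import Relation.Nullary using (¬_; yes; no; contradiction)

-- Cauchy products of sequences

module Convolution {c ℓ} (R : CommutativeSemiring c ℓ) where

  open CommutativeSemiring R
  open Polynomial rawSemiring
  open CommutativeSemigroupProperties
    (CommutativeSemiring.+-commutativeSemigroup R) using (interchange; x∙yz≈y∙xz)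
  open SetoidReasoning setoid

  Series : Set c
  Series = ℕ → Carrier

  -- The Cauchy product, taken on arbitrary sequences because the inverse of a factor is at first
  -- only a power series.
  conv : Series → Series → Series
  conv s t zero    = s 0 * t 0
  conv s t (suc k) = s 0 * t (suc k) + conv (s ∘ suc) t k

  conv-cong : ∀ {s s′ t t′} → (∀ i → s i ≈ s′ i) → (∀ i → t i ≈ t′ i) →
              ∀ k → conv s t k ≈ conv s′ t′ k
  conv-cong s≈ t≈ zero    = *-cong (s≈ 0) (t≈ 0)
  conv-cong s≈ t≈ (suc k) =
    +-cong (*-cong (s≈ 0) (t≈ (suc k))) (conv-cong (s≈ ∘ suc) t≈ k)

  conv-zeroˡ : ∀ {s} t → (∀ i → s i ≈ 0#) → ∀ k → conv s t k ≈ 0#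
  conv-zeroˡ t s≈0 zero    = trans (*-congʳ (s≈0 0)) (zeroˡ _)
  conv-zeroˡ t s≈0 (suc k) = trans
    (+-cong (trans (*-congʳ (s≈0 0)) (zeroˡ _)) (conv-zeroˡ t (s≈0 ∘ suc) k))
    (+-identityˡ _)

  conv-*ˡ : ∀ a s t k → conv (λ i → a * s i) t k ≈ a * conv s t k
  conv-*ˡ a s t zero    = *-assoc _ _ _
  conv-*ˡ a s t (suc k) =
    trans (+-cong (*-assoc _ _ _) (conv-*ˡ a (s ∘ suc) t k)) (sym (distribˡ _ _ _))

  conv-+ˡ : ∀ s s′ t k → conv (λ i → s i + s′ i) t k ≈ conv s t k + conv s′ t k
  conv-+ˡ s s′ t zero    = distribʳ _ _ _
  conv-+ˡ s s′ t (suc k) = trans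
    (+-cong (distribʳ _ _ _) (conv-+ˡ (s ∘ suc) (s′ ∘ suc) t k)) (interchange _ _ _ _)

  -- `conv` peels off `s 0`; peeling off `t 0` instead is what the induction for `conv-comm` needs.
  conv-suc : ∀ s t k → conv s t (suc k) ≈ s (suc k) * t 0 + conv s (t ∘ suc) k
  conv-suc s t zero    = +-comm _ _
  conv-suc s t (suc k) =
    trans (+-congˡ (conv-suc (s ∘ suc) t k)) (x∙yz≈y∙xz _ _ _)

  conv-comm : ∀ s t k → conv s t k ≈ conv t s k
  conv-comm s t zero    = *-comm _ _
  conv-comm s t (suc k) =
    trans (+-cong (*-comm _ _) (conv-comm (s ∘ suc) t k)) (sym (conv-suc t s k))

  conv-assoc : ∀ s t r k → conv (conv s t) r k ≈ conv s (conv t r) k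
  conv-assoc s t r zero    = *-assoc _ _ _
  conv-assoc s t r (suc k) = begin
    s 0 * t 0 * r (suc k) + conv (conv s t ∘ suc) r k
      ≈⟨ +-cong (*-assoc _ _ _) (conv-+ˡ _ _ r k) ⟩
    s 0 * (t 0 * r (suc k)) + (conv (λ i → s 0 * t (suc i)) r k + conv (conv (s ∘ suc) t) r k)
      ≈⟨ +-congˡ (+-cong (conv-*ˡ _ _ r k) (conv-assoc (s ∘ suc) t r k)) ⟩
    s 0 * (t 0 * r (suc k)) + (s 0 * conv (t ∘ suc) r k + conv (s ∘ suc) (conv t r) k)
      ≈⟨ +-assoc _ _ _ ⟨
    s 0 * (t 0 * r (suc k)) + s 0 * conv (t ∘ suc) r k + conv (s ∘ suc) (conv t r) k
      ≈⟨ +-congʳ (distribˡ _ _ _) ⟨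
    conv s (conv t r) (suc k) ∎

  conv-constant : ∀ a t k → conv (coeff (constant a)) t k ≈ a * t k
  conv-constant a t zero    = refl
  conv-constant a t (suc k) =
    trans (+-congˡ (conv-zeroˡ t (λ _ → refl) k)) (+-identityʳ _)

  conv-identityˡ : ∀ t k → conv (coeff (constant 1#)) t k ≈ t k
  conv-identityˡ t k = trans (conv-constant 1# t k) (*-identityˡ _)

  conv-identityʳ : ∀ t k → conv t (coeff (constant 1#)) k ≈ t k
  conv-identityʳ t k = trans (conv-comm t _ k) (conv-identityˡ t k)

  coeff-+ : ∀ f g k → coeff (f +ₚ g) k ≈ coeff f k + coeff g k
  coeff-+ []      g       k       = sym (+-identityˡ _)
  coeff-+ (a ∷ f) []      k       = sym (+-identityʳ _)
  coeff-+ (a ∷ f) (b ∷ g) zero    = refl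
  coeff-+ (a ∷ f) (b ∷ g) (suc k) = coeff-+ f g k

  coeff-map-* : ∀ a f k → coeff (map (a *_) f) k ≈ a * coeff f k
  coeff-map-* a []      k       = sym (zeroʳ _)
  coeff-map-* a (b ∷ f) zero    = refl
  coeff-map-* a (b ∷ f) (suc k) = coeff-map-* a f k

  coeff-* : ∀ f g k → coeff (f *ₚ g) k ≈ conv (coeff f) (coeff g) k
  coeff-* []      g k       = sym (conv-zeroˡ _ (λ _ → refl) k)
  coeff-* (a ∷ f) g zero    = trans (coeff-+ (map (a *_) g) _ 0)
    (trans (+-identityʳ _) (coeff-map-* a g 0))
  coeff-* (a ∷ f) g (suc k) = trans (coeff-+ (map (a *_) g) _ (suc k))
    (+-cong (coeff-map-* a g (suc k)) (coeff-* f g k))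

open import Data.Nat.Base hiding (_/_)
open import Data.Nat.Properties
open import Relation.Binary.PropositionalEquality

module ℤ* = Convolution ℤₚ.+-*-commutativeSemiring
module ℚ* = Convolution (CommutativeRing.commutativeSemiring ℚₚ.+-*-commutativeRing)
module ℚ-semigroup = CommutativeSemigroupProperties
  (CommutativeRing.*-commutativeSemigroup ℚₚ.+-*-commutativeRing)

open ℤ* using (conv)
open ℤ[x] using (Poly; coeff; monomial; constant; sumₚ)
open RawSemiringDefs ℚ[x].polyRawSemiring using () renaming (_∣_ to _∣ₓ_)

-- Divisibility of coefficients of products

∣-+ : ∀ N a b → + N ∣ a → + N ∣ b → + N ∣ a ℤ.+ b
∣-+ N a b N∣a N∣b = Signed.∣⇒∣ᵤ {+ N} {a ℤ.+ b}
  (Signed.∣m∣n⇒∣m+n (Signed.∣ᵤ⇒∣ {+ N} {a} N∣a) (Signed.∣ᵤ⇒∣ {+ N} {b} N∣b))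

∣-+-cancelˡ : ∀ N a b → + N ∣ a ℤ.+ b → + N ∣ a → + N ∣ b
∣-+-cancelˡ N a b N∣a+b N∣a = Signed.∣⇒∣ᵤ {+ N} {b}
  (Signed.∣m+n∣m⇒∣n (Signed.∣ᵤ⇒∣ {+ N} {a ℤ.+ b} N∣a+b) (Signed.∣ᵤ⇒∣ {+ N} {a} N∣a))

∣-+-cancelʳ : ∀ N a b → + N ∣ a ℤ.+ b → + N ∣ b → + N ∣ a
∣-+-cancelʳ N a b N∣a+b N∣b = Signed.∣⇒∣ᵤ {+ N} {a}
  (Signed.∣m+n∣n⇒∣m {n = b} (Signed.∣ᵤ⇒∣ {+ N} {a ℤ.+ b} N∣a+b) (Signed.∣ᵤ⇒∣ {+ N} {b} N∣b))

∣-* : ∀ M N a b → + M ∣ a → + N ∣ b → + (M * N) ∣ a ℤ.* b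
∣-* M N a b M∣a N∣b = subst (M * N ℕ∣.∣_) (sym (ℤₚ.abs-* a b)) (ℕ∣.*-pres-∣ M∣a N∣b)

conv-∣ : ∀ N s t k → (∀ i j → i + j ≡ k → + N ∣ s i ℤ.* t j) → + N ∣ conv s t k
conv-∣ N s t zero    N∣ = N∣ 0 0 refl
conv-∣ N s t (suc k) N∣ = ∣-+ N (s 0 ℤ.* t (suc k)) (conv (s ∘ suc) t k) (N∣ 0 (suc k) refl)
  (conv-∣ N (s ∘ suc) t k (λ i j eq → N∣ (suc i) j (cong suc eq)))

-- Divisibility is decidable, so a failing term can be searched for. Applied to p ∤ aₘ, it yields
-- the pair with i + j = m.
conv-∤⇒∃∤ : ∀ N s t k → ¬ (+ N ∣ conv s t k) →
            ∃₂ λ i j → i + j ≡ k × ¬ (+ N ∣ s i ℤ.* t j)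
conv-∤⇒∃∤ N s t zero    N∤ = 0 , 0 , refl , N∤
conv-∤⇒∃∤ N s t (suc k) N∤ with N ℕ∣.∣? ∣ s 0 ℤ.* t (suc k) ∣
... | no  N∤₀ = 0 , suc k , refl , N∤₀
... | yes N∣₀ with conv-∤⇒∃∤ N (s ∘ suc) t k 
                     (N∤ ∘ ∣-+ N (s 0 ℤ.* t (suc k)) (conv (s ∘ suc) t k) N∣₀)
...   | i , j , eq , N∤ᵢⱼ = suc i , j , cong suc eq , N∤ᵢⱼ

-- Modulo `N` only one term of the sum survives. With `N` a power of p this isolates lowest terms,
-- with `N = 0` leading terms.
conv-∤ : ∀ N s t i j → ¬ (+ N ∣ s i ℤ.* t j) →
         (∀ i′ j′ → i′ + j′ ≡ i + j → i′ ≢ i → + N ∣ s i′ ℤ.* t j′) →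
         ¬ (+ N ∣ conv s t (i + j))
conv-∤ N s t zero    zero    N∤ N∣ = N∤
conv-∤ N s t zero    (suc j) N∤ N∣ N∣conv = N∤ $
  ∣-+-cancelʳ N (s 0 ℤ.* t (suc j)) (conv (s ∘ suc) t j) N∣conv
    (conv-∣ N (s ∘ suc) t j λ i′ j′ eq → N∣ (suc i′) j′ (cong suc eq) λ ())
conv-∤ N s t (suc i) j       N∤ N∣ N∣conv =
  conv-∤ N (s ∘ suc) t i j N∤
    (λ i′ j′ eq i′≢i → N∣ (suc i′) j′ (cong suc eq) (i′≢i ∘ suc-injective))
    (∣-+-cancelˡ N (s 0 ℤ.* t (suc (i + j))) (conv (s ∘ suc) t (i + j)) N∣conv
      (N∣ 0 (suc (i + j)) refl λ ()))

-- Exact powers of a prime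

^-monoʳ-∣ : ∀ p {d e} → d ≤ e → p ^ d ℕ∣.∣ p ^ e
^-monoʳ-∣ p {d} {e} d≤e = ℕ∣.divides (p ^ (e ∸ d)) $ begin
  p ^ e               ≡⟨ cong (p ^_) (m∸n+n≡m d≤e) ⟨
  p ^ (e ∸ d + d)     ≡⟨ ^-distribˡ-+-* p (e ∸ d) d ⟩
  p ^ (e ∸ d) * p ^ d ∎
  where open ≡-Reasoning

∣-downward : ∀ p {d e a} → d ≤ e → p ^ e ℕ∣.∣ a → p ^ d ℕ∣.∣ a
∣-downward p d≤e = ℕ∣.∣-trans (^-monoʳ-∣ p d≤e)

-- The relation v_p(a) = v. No `v` satisfies it for a = 0, whose valuation is infinite.
ExactPower : ℕ → ℕ → ℕ → Set
ExactPower p v a = p ^ v ℕ∣.∣ a × ¬ (p ^ suc v ℕ∣.∣ a)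

exactPower-≤ : ∀ p {v e a} → ExactPower p v a → p ^ e ℕ∣.∣ a → e ≤ v
exactPower-≤ p {v} {e} (_ , ∤) ∣ with e ≤? v
... | yes e≤v = e≤v
... | no  e≰v = ⊥-elim (∤ (∣-downward p (≰⇒> e≰v) ∣))

module _ {p} (p-prime : Prime p) where

  private instance
    p≢0 : NonZero p
    p≢0 = prime⇒nonZero p-prime

  1<p : 1 < p
  1<p = nonTrivial⇒n>1 p {{prime⇒nonTrivial p-prime}}

  n<p^n : ∀ n → n < p ^ n
  n<p^n zero    = s≤s z≤n
  n<p^n (suc n) = ≤-<-trans (n<p^n n)
    (subst (_< p * p ^ n) (*-identityˡ (p ^ n)) (*-monoˡ-< (p ^ n) {{m^n≢0 p n}} 1<p))

  private
    search : ∀ a k → ¬ (p ^ k ℕ∣.∣ a) → ∃ λ v → ExactPower p v a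
    search a zero    ∤ = ⊥-elim (∤ (ℕ∣.1∣ a))
    search a (suc k) ∤ with p ^ k ℕ∣.∣? a
    ... | yes ∣ = k , ∣ , ∤
    ... | no ∤′ = search a k ∤′

  exactPower : ∀ a → a ≢ 0 → ∃ λ v → ExactPower p v a
  -- By `n<p^n`, p ^ a is too large to divide a ≠ 0, so the downward search can start at the
  -- exponent a.
  exactPower a a≢0 = search a a (ℕ∣.>⇒∤ {{≢-nonZero a≢0}} (n<p^n a))

  exactPower-^ : ∀ v → ExactPower p v (p ^ v)
  exactPower-^ v = ℕ∣.∣-refl , ℕ∣.>⇒∤ {{m^n≢0 p v}}
    (subst (_< p * p ^ v) (*-identityˡ (p ^ v)) (*-monoˡ-< (p ^ v) {{m^n≢0 p v}} 1<p))

  -- After cancelling p ^ (v + w), Euclid's lemma would hand a surplus factor p to one of the two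
  -- cofactors.
  exactPower-* : ∀ {v w a b} → ExactPower p v a → ExactPower p w b →
                 ExactPower p (v + w) (a * b)
  exactPower-* {v} {w} (ℕ∣.divides a′ refl , ∤a) (ℕ∣.divides b′ refl , ∤b) =
    ℕ∣.divides (a′ * b′) eq , λ ∣ab →
      [ (λ p∣a′ → ∤a (ℕ∣.*-monoˡ-∣ (p ^ v) p∣a′))
      , (λ p∣b′ → ∤b (ℕ∣.*-monoˡ-∣ (p ^ w) p∣b′))
      ]′ (euclidsLemma a′ b′ p-prime
            (ℕ∣.*-cancelʳ-∣ (p ^ (v + w)) {{m^n≢0 p (v + w)}}
              (subst (p ^ suc (v + w) ℕ∣.∣_) eq ∣ab)))
    where
    eq : a′ * p ^ v * (b′ * p ^ w) ≡ a′ * b′ * p ^ (v + w)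
    eq = trans ([m*n]*[o*p]≡[m*o]*[n*p] a′ (p ^ v) b′ (p ^ w))
           (cong (a′ * b′ *_) (sym (^-distribˡ-+-* p v w)))

  -- Induction on `u`: Euclid's lemma strips one factor p from `a` or from `b`.
  m*n≡p^u⇒powers : ∀ u a b → a * b ≡ p ^ u →
                   ∃₂ λ α β → a ≡ p ^ α × b ≡ p ^ β × α + β ≡ u
  m*n≡p^u⇒powers zero    a b eq = 0 , 0 , m*n≡1⇒m≡1 a b eq , m*n≡1⇒n≡1 a b eq , refl
  m*n≡p^u⇒powers (suc u) a b eq
    with euclidsLemma a b p-prime (ℕ∣.divides (p ^ u) (trans eq (*-comm p (p ^ u))))
  ... | inj₁ (ℕ∣.divides a′ refl)
    with α , β , eqα , eqβ , α+β ← m*n≡p^u⇒powers u a′ b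
           (*-cancelˡ-≡ (a′ * b) (p ^ u) p (trans
             (trans (sym (*-assoc p a′ b)) (cong (_* b) (*-comm p a′))) eq))
    = suc α , β , trans (*-comm a′ p) (cong (p *_) eqα) , eqβ , cong suc α+β
  ... | inj₂ (ℕ∣.divides b′ refl)
    with α , β , eqα , eqβ , α+β ← m*n≡p^u⇒powers u a b′
           (*-cancelʳ-≡ (a * b′) (p ^ u) p (trans
             (trans (*-assoc a b′ p) eq) (*-comm p (p ^ u))))
    = α , suc β , eqα , trans (*-comm b′ p) (cong (p *_) eqβ)
    , trans (+-suc α β) (cong suc α+β)

-- Weights and lowest terms

-- HasWeight p μ υ s w j says w ≤ μ v_p(s j) + υ j, where v_p(0) = ∞.
HasWeight : (p μ υ : ℕ) → (ℕ → ℤ) → ℕ → ℕ → Set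
HasWeight p μ υ s w j = ∃ λ e → + (p ^ e) ∣ s j × w ≤ μ * e + υ * j

-- Among the points (j, v_p(s j)) of the Newton diagram, the leftmost one on the supporting line μ v
-- + υ j = `weight`. Taking the leftmost prevents lowest terms from cancelling in a product.
record Lowest (p μ υ : ℕ) (s : ℕ → ℤ) : Set where
  field
    index valuation : ℕ
    exact : ExactPower p valuation ∣ s index ∣

  weight : ℕ
  weight = μ * valuation + υ * index

  field
    minimal : ∀ j → HasWeight p μ υ s weight j
    first   : ∀ j → j < index → HasWeight p μ υ s (suc weight) j

module _ {p} (p-prime : Prime p) (μ υ : ℕ) .{{μ≢0 : NonZero μ}} where

  private
    weigh : ∀ t a → (∃ λ e → + (p ^ e) ∣ a × t ≤ μ * e) ⊎
                    (∃ λ v → ExactPower p v ∣ a ∣ × μ * v < t)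
    weigh t a with ∣ a ∣ ≟ 0
    -- A zero coefficient is divisible by every power; the exponent t is large enough since μ ≥ 1.
    ... | yes a≡0 = inj₁ (t , subst (p ^ t ℕ∣.∣_) (sym a≡0) ((p ^ t) ℕ∣.∣0) , m≤n*m t μ)
    ... | no a≢0 with exactPower p-prime ∣ a ∣ a≢0
    ...   | v , exact with t ≤? μ * v
    ...     | yes t≤ = inj₁ (v , proj₁ exact , t≤)
    ...     | no  t≰ = inj₂ (v , exact , ≰⇒> t≰)

    +-*-suc : ∀ w j → w + υ * suc j ≡ υ + (w + υ * j)
    +-*-suc w j = solve 3 (λ w υ j → w :+ υ :* (con 1 :+ j) := υ :+ (w :+ υ :* j)) refl w υ j
      where open +-*-Solver

    shift : ∀ {v i e j} → μ * v + υ * i ≤ μ * e + υ * j →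
            μ * v + υ * suc i ≤ μ * e + υ * suc j
    shift {v} {i} {e} {j} le =
      subst₂ _≤_ (sym (+-*-suc (μ * v) i)) (sym (+-*-suc (μ * e) j)) (+-monoʳ-≤ υ le)

    shift-< : ∀ {v i e j} → suc (μ * v + υ * i) ≤ μ * e + υ * j →
              suc (μ * v + υ * suc i) ≤ μ * e + υ * suc j
    shift-< {v} {i} {e} {j} le =
      subst₂ _<_ (sym (+-*-suc (μ * v) i)) (sym (+-*-suc (μ * e) j)) (+-monoʳ-< υ le)

    ≤-+υ0 : ∀ {w e} → w ≤ μ * e → w ≤ μ * e + υ * 0
    ≤-+υ0 w≤ = ≤-trans w≤ (m≤m+n _ _)

    μv+υ0≤ : ∀ v {w} → μ * v ≤ w → μ * v + υ * 0 ≤ w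
    μv+υ0≤ v {w} = subst (_≤ w) (sym (trans (cong (λ k → μ * v + k) (*-zeroʳ υ)) (+-identityʳ _)))

  -- A new constant term moves the others up by one index. This adds υ to each of their weights and
  -- preserves their order, so only `a` and the old lowest term compete.
  lowest : ∀ f → (∀ i → coeff f i ≡ 0ℤ) ⊎ Lowest p μ υ (coeff f)
  lowest []      = inj₁ λ _ → refl
  lowest (a ∷ f) with lowest f
  ... | inj₁ f≡0 with ∣ a ∣ ≟ 0
  ...   | yes a≡0 = inj₁ λ { zero → ℤₚ.∣i∣≡0⇒i≡0 a≡0 ; (suc i) → f≡0 i }
  ...   | no  a≢0 with v , exact ← exactPower p-prime ∣ a ∣ a≢0 = inj₂ record
    { index     = 0
    ; valuation = v
    ; exact     = exact
    ; minimal   = λ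
      { zero    → v , proj₁ exact , ≤-refl
      ; (suc j) → v , subst (λ z → + (p ^ v) ∣ z) (sym (f≡0 j)) ((p ^ v) ℕ∣.∣0)
                , μv+υ0≤ v (m≤m+n (μ * v) (υ * suc j))
      }
    ; first     = λ _ ()
    }
  -- The threshold is one above the shifted weight: a tie goes to `a`, which comes first.
  lowest (a ∷ f) | inj₂ L with weigh (suc (μ * valuation + υ * suc index)) a
    where open Lowest L
  ... | inj₁ (e , p^e∣a , w<) = inj₂ record
    { index     = suc index
    ; valuation = valuation
    ; exact     = exact
    ; minimal   = λ
      { zero    → e , p^e∣a , ≤-+υ0 (<⇒≤ w<)
      ; (suc j) → let e , d , le = minimal j in e , d , shift le
      }
    ; first     = λ
      { zero    _         → e , p^e∣a , ≤-+υ0 w<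
      ; (suc j) (s≤s j<i) → let e , d , le = first j j<i in e , d , shift-< le
      }
    }
    where open Lowest L
  ... | inj₂ (v , exactᵃ , s≤s v≤) = inj₂ record
    { index     = 0
    ; valuation = v
    ; exact     = exactᵃ
    ; minimal   = λ
      { zero    → v , proj₁ exactᵃ , ≤-refl
      ; (suc j) → let e , d , le = minimal j in
                  e , d , μv+υ0≤ v (≤-trans v≤ (shift {valuation} {index} {e} {j} le))
      }
    ; first     = λ _ ()
    }
    where open Lowest L

  -- In any other term of this coefficient, i′ < i or j′ < j. That factor is strictly heavier by
  -- `first`, and the other is not lighter by `minimal`, so the lowest pair alone determines the
  -- valuation.
  conv-lowest-∤ : ∀ {s t} (L : Lowest p μ υ s) (M : Lowest p μ υ t) →
    ¬ (+ (p ^ suc (Lowest.valuation L + Lowest.valuation M)) ∣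
       conv s t (Lowest.index L + Lowest.index M))
  conv-lowest-∤ {s} {t} L M = conv-∤ (p ^ suc (v + w)) s t i j
    (proj₂ (subst (ExactPower p (v + w)) (sym (ℤₚ.abs-* (s i) (t j)))
      (exactPower-* p-prime {v} {w} L.exact M.exact)))
    other
    where
    module L = Lowest L
    module M = Lowest M
    v = L.valuation
    w = M.valuation
    i = L.index
    j = M.index

    rearrange : ∀ e d i j → μ * e + υ * i + (μ * d + υ * j) ≡ μ * (e + d) + υ * (i + j)
    rearrange e d i j = solve 6
      (λ μ υ e d i j → μ :* e :+ υ :* i :+ (μ :* d :+ υ :* j) := μ :* (e :+ d) :+ υ :* (i :+ j))
      refl μ υ e d i j
      where open +-*-Solver

    combine : ∀ i′ j′ → i′ + j′ ≡ i + j → ∀ e d →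
              + (p ^ e) ∣ s i′ → + (p ^ d) ∣ t j′ →
              L.weight + M.weight < μ * e + υ * i′ + (μ * d + υ * j′) →
              + (p ^ suc (v + w)) ∣ s i′ ℤ.* t j′
    combine i′ j′ eq e d p^e∣ p^d∣ lt = ∣-downward p v+w<e+d
      (subst (λ q → + q ∣ s i′ ℤ.* t j′) (sym (^-distribˡ-+-* p e d))
        (∣-* (p ^ e) (p ^ d) (s i′) (t j′) p^e∣ p^d∣))
      where
      -- The indices of both pairs sum to i + j, so the υ-parts cancel and the surplus weight is a
      -- surplus of valuation.
      v+w<e+d : v + w < e + d
      v+w<e+d = *-cancelˡ-< μ (v + w) (e + d)
        (+-cancelʳ-< (υ * (i + j)) (μ * (v + w)) (μ * (e + d))
          (subst₂ _<_ (rearrange v w i j)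
            (trans (rearrange e d i′ j′) (cong (λ k → μ * (e + d) + υ * k) eq)) lt))

    other : ∀ i′ j′ → i′ + j′ ≡ i + j → i′ ≢ i → + (p ^ suc (v + w)) ∣ s i′ ℤ.* t j′
    other i′ j′ eq i′≢i with <-cmp i′ i
    ... | tri< i′<i _ _ =
      let e , p^e∣ , lt = L.first i′ i′<i
          d , p^d∣ , le = M.minimal j′
      in combine i′ j′ eq e d p^e∣ p^d∣ (+-mono-<-≤ lt le)
    ... | tri≈ _ i′≡i _ = contradiction i′≡i i′≢i
    ... | tri> _ _ i<i′ =
      let e , p^e∣ , le = L.minimal i′
          d , p^d∣ , lt = M.first j′
            (+-cancelˡ-< i j′ j (subst (i + j′ <_) eq (+-monoˡ-< j′ i<i′)))
      in combine i′ j′ eq e d p^e∣ p^d∣ (+-mono-≤-< le lt)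

-- Factorisations over ℤ with both constant terms divisible by p

-- Used to turn upper bounds on w(g) and w(h) into equalities, once their total is known to be
-- reached.
squeeze : ∀ {a b c d} → a ≤ c → b ≤ d → c + d ≤ a + b → a ≡ c
squeeze {a} {b} {c} {d} a≤c b≤d c+d≤a+b = ≤-antisym a≤c
  (+-cancelʳ-≤ d c a (≤-trans c+d≤a+b (+-monoʳ-≤ a b≤d)))

-- With μ = m and υ = u, the points (0, u) and (m, 0) of f both have weight m u: they span the side
-- of slope -u/m.
newton-irreducible : ∀ {p} → Prime p → ∀ u m → m ≥ 1 → gcd u m ≡ 1 →
  ∀ g h {α β} → ∣ coeff g 0 ∣ ≡ p ^ suc α → ∣ coeff h 0 ∣ ≡ p ^ suc β → suc α + suc β ≡ u →
  (∀ k → HasWeight p m u (conv (coeff g) (coeff h)) (m * u) k) →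
  ¬ (+ p ∣ conv (coeff g) (coeff h) m) → ⊥
newton-irreducible {p} p-prime u m m≥1 gcd≡1 g h {α} {β} g₀ h₀ α+β weights p∤
  with lowest p-prime m u {{>-nonZero m≥1}} g | lowest p-prime m u {{>-nonZero m≥1}} h
     | conv-∤⇒∃∤ p (coeff g) (coeff h) m p∤
... | inj₁ g≡0 | _ | _ = m<n⇒n≢0 (m^n>0 p {{prime⇒nonZero p-prime}} (suc α))
  (trans (sym g₀) (cong ∣_∣ (g≡0 0)))
... | inj₂ _ | inj₁ h≡0 | _ = m<n⇒n≢0 (m^n>0 p {{prime⇒nonZero p-prime}} (suc β))
  (trans (sym h₀) (cong ∣_∣ (h≡0 0)))
... | inj₂ L | inj₂ M | i , j , i+j≡m , p∤gᵢhⱼ = ends i j i+j≡m (trans (sym wL≡ui) wL≡mα)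
                                               (trans (sym wM≡uj) wM≡mβ)
  where
  module L = Lowest L
  module M = Lowest M

  -- The constant term gives the point (0, γ), of weight m γ; in `weight≤u*`, a coefficient prime to
  -- p gives (i, 0), of weight u i.
  weight≤m* : ∀ {s} (K : Lowest p m u s) {γ} → ∣ s 0 ∣ ≡ p ^ γ → Lowest.weight K ≤ m * γ
  weight≤m* {s} K {γ} s₀ with Lowest.minimal K 0
  ... | e , p^e∣ , le = ≤-trans le $ subst (_≤ m * γ) (sym
    (trans (cong (λ k → m * e + k) (*-zeroʳ u)) (+-identityʳ (m * e))))
    (*-monoʳ-≤ m (exactPower-≤ p {γ} (exactPower-^ p-prime γ) (subst (p ^ e ℕ∣.∣_) s₀ p^e∣)))

  weight≤u* : ∀ {s} (K : Lowest p m u s) i → ¬ (+ p ∣ s i) → Lowest.weight K ≤ u * i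
  weight≤u* {s} K i p∤sᵢ with Lowest.minimal K i
  ... | zero  , _    , le = subst (λ k → Lowest.weight K ≤ k + u * i) (*-zeroʳ m) le
  ... | suc e , p^e∣ , _  = contradiction (ℕ∣.m*n∣⇒m∣ p (p ^ e) p^e∣) p∤sᵢ

  -- The coefficient of the product at the sum of the two lowest indices weighs at least m u, while
  -- `conv-lowest-∤` bounds its valuation from above.
  total : m * u ≤ L.weight + M.weight
  total with weights (L.index + M.index)
  ... | e , p^e∣ , le = begin
    m * u                                                   ≤⟨ le ⟩
    m * e + u * (L.index + M.index)                         ≤⟨ +-monoˡ-≤ _ (*-monoʳ-≤ m e≤) ⟩
    m * (L.valuation + M.valuation) + u * (L.index + M.index)
      ≡⟨ solve 6 (λ m u e d i j → m :* (e :+ d) :+ u :* (i :+ j) :=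
                                  m :* e :+ u :* i :+ (m :* d :+ u :* j))
           refl m u L.valuation M.valuation L.index M.index ⟩
    L.weight + M.weight                                     ∎
    where
    open ≤-Reasoning
    open +-*-Solver
    e≤ : e ≤ L.valuation + M.valuation
    e≤ with e ≤? L.valuation + M.valuation
    ... | yes e≤ = e≤
    ... | no  e≰ = contradiction (∣-downward p (≰⇒> e≰) p^e∣)
                     (conv-lowest-∤ p-prime m u {{>-nonZero m≥1}} L M)

  p∤gᵢ : ¬ (+ p ∣ coeff g i)
  p∤gᵢ p∣ = p∤gᵢhⱼ (subst (p ℕ∣.∣_) (sym (ℤₚ.abs-* (coeff g i) (coeff h j)))
    (ℕ∣.∣m⇒∣m*n _ p∣))
  p∤hⱼ : ¬ (+ p ∣ coeff h j)
  p∤hⱼ p∣ = p∤gᵢhⱼ (subst (p ℕ∣.∣_) (sym (ℤₚ.abs-* (coeff g i) (coeff h j)))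
    (ℕ∣.∣n⇒∣m*n ∣ coeff g i ∣ p∣))

  total-u : u * i + u * j ≤ L.weight + M.weight
  total-u = subst (_≤ L.weight + M.weight)
    (trans (*-comm m u) (trans (cong (u *_) (sym i+j≡m)) (*-distribˡ-+ u i j))) total

  total-m : m * suc α + m * suc β ≤ L.weight + M.weight
  total-m = subst (_≤ L.weight + M.weight)
    (trans (cong (m *_) (sym α+β)) (*-distribˡ-+ m (suc α) (suc β))) total

  -- Both u i + u j and m (α + 1) + m (β + 1) equal m u, so none of the four bounds leaves any
  -- slack.
  wL≡ui = squeeze (weight≤u* L i p∤gᵢ) (weight≤u* M j p∤hⱼ) total-u
  wL≡mα = squeeze (weight≤m* L g₀) (weight≤m* M h₀) total-m
  wM≡uj = squeeze (weight≤u* M j p∤hⱼ) (weight≤u* L i p∤gᵢ)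
    (subst₂ _≤_ (+-comm (u * i) (u * j)) (+-comm L.weight M.weight) total-u)
  wM≡mβ = squeeze (weight≤m* M h₀) (weight≤m* L g₀)
    (subst₂ _≤_ (+-comm (m * suc α) (m * suc β)) (+-comm L.weight M.weight) total-m)

  0≢m* : ∀ γ → u * 0 ≢ m * suc γ
  0≢m* γ eq = m<n⇒n≢0 (*-mono-≤ m≥1 (s≤s (z≤n {γ}))) (trans (sym eq) (*-zeroʳ u))

  -- Coprimality gives m ∣ i, and i ≤ m, so i is 0 or m. Then i or j is 0, although m (α + 1) and m
  -- (β + 1) are positive.
  ends : ∀ i j → i + j ≡ m → u * i ≡ m * suc α → u * j ≡ m * suc β → ⊥
  ends zero    j i+j≡m ui≡mα uj≡mβ = 0≢m* α ui≡mα
  ends i@(suc _) j i+j≡m ui≡mα uj≡mβ = 0≢m* β (trans (cong (u *_) (sym j≡0)) uj≡mβ)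
    where
    m∣i : m ℕ∣.∣ i
    m∣i = coprime-divisor {n = u} (Coprimality.sym (gcd≡1⇒coprime gcd≡1))
      (ℕ∣.divides (suc α) (trans ui≡mα (*-comm m (suc α))))
    j≡0 : j ≡ 0
    j≡0 = n≤0⇒n≡0 (+-cancelˡ-≤ i j 0
      (subst₂ _≤_ (sym i+j≡m) (sym (+-identityʳ i)) (ℕ∣.∣⇒≤ m∣i)))

-- Gauss' lemma

private
  positive : ∀ {q s v} (L : Lowest q 1 0 s) → Lowest.valuation L ≡ suc v → ∀ i → + q ∣ s i
  positive {q} L v≡ i with Lowest.minimal L i
  ... | suc e , q^e∣ , _  = ℕ∣.m*n∣⇒m∣ q (q ^ e) q^e∣
  ... | zero  , _    , le with () ← subst (λ v → 1 * v + 0 * Lowest.index L ≤ 0) v≡ le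

-- For μ = 1 and υ = 0 the lowest weight is the exponent of q in the content. If it is 0 for both
-- factors, `conv-lowest-∤` exhibits a coefficient of the product prime to q.
gauss : ∀ {q} → Prime q → ∀ g h → (∀ k → + q ∣ conv (coeff g) (coeff h) k) →
        (∀ i → + q ∣ coeff g i) ⊎ (∀ i → + q ∣ coeff h i)
gauss {q} q-prime g h q∣ with lowest q-prime 1 0 g | lowest q-prime 1 0 h
... | inj₁ g≡0 | _ = inj₁ λ i → subst (λ z → + q ∣ z) (sym (g≡0 i)) (q ℕ∣.∣0)
... | inj₂ _ | inj₁ h≡0 = inj₂ λ i → subst (λ z → + q ∣ z) (sym (h≡0 i)) (q ℕ∣.∣0)
... | inj₂ L | inj₂ M with Lowest.valuation L in v≡ | Lowest.valuation M in w≡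
...   | suc v | _     = inj₁ (positive L v≡)
...   | zero  | suc w = inj₂ (positive M w≡)
...   | zero  | zero  = contradiction
  (subst (ℕ∣._∣ ∣ conv (coeff g) (coeff h) (Lowest.index L + Lowest.index M) ∣)
     (sym (trans (cong₂ (λ v w → q ^ suc (v + w)) v≡ w≡) (*-identityʳ q)))
     (q∣ (Lowest.index L + Lowest.index M)))
  (conv-lowest-∤ q-prime 1 0 L M)

divideBy : ∀ q g → (∀ i → + q ∣ coeff g i) → ∃ λ g′ → ∀ i → coeff g i ≡ + q ℤ.* coeff g′ i
divideBy q []      q∣ = [] , λ _ → sym (ℤₚ.*-zeroʳ (+ q))
divideBy q (a ∷ g) q∣
  with Signed.divides c a≡cq ← Signed.∣ᵤ⇒∣ {+ q} {a} (q∣ 0)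
     | g′ , g≡ ← divideBy q g (q∣ ∘ suc)
  = c ∷ g′ , λ { zero → trans a≡cq (ℤₚ.*-comm c (+ q)) ; (suc i) → g≡ i }

-- Factors with constant term ±1

coeff-monomial-≡ : ∀ c i → coeff (monomial c i) i ≡ c
coeff-monomial-≡ c zero    = refl
coeff-monomial-≡ c (suc i) = coeff-monomial-≡ c i

coeff-monomial-≢ : ∀ c {i k} → k ≢ i → coeff (monomial c i) k ≡ 0ℤ
coeff-monomial-≢ c {zero}  {zero}  k≢i = contradiction refl k≢i
coeff-monomial-≢ c {zero}  {suc k} k≢i = refl
coeff-monomial-≢ c {suc i} {zero}  k≢i = refl
coeff-monomial-≢ c {suc i} {suc k} k≢i = coeff-monomial-≢ c (k≢i ∘ cong suc)

sumOfMonomials : (ℕ → ℤ) → List ℕ → Poly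
sumOfMonomials a l = sumₚ (map (λ i → monomial (a i) i) l)

coeff-sum-∉ : ∀ a {l k} → k ∉ l → coeff (sumOfMonomials a l) k ≡ 0ℤ
coeff-sum-∉ a {[]}    {k} k∉ = refl
coeff-sum-∉ a {i ∷ l} {k} k∉ = trans
  (ℤ*.coeff-+ (monomial (a i) i) (sumOfMonomials a l) k)
  (cong₂ ℤ._+_ (coeff-monomial-≢ (a i) (k∉ ∘ here)) (coeff-sum-∉ a (k∉ ∘ there)))

coeff-sum-∈ : ∀ a {l k} → Unique l → k ∈ l → coeff (sumOfMonomials a l) k ≡ a k
coeff-sum-∈ a {i ∷ l} (i∉l ∷ _) (here refl) = trans
  (ℤ*.coeff-+ (monomial (a i) i) (sumOfMonomials a l) i)
  (trans (cong₂ ℤ._+_ (coeff-monomial-≡ (a i) i)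
                      (coeff-sum-∉ a (λ i∈l → All.lookup i∉l i∈l refl)))
         (ℤₚ.+-identityʳ (a i)))
coeff-sum-∈ a {i ∷ l} {k} (i∉l ∷ l!) (there k∈l) = trans
  (ℤ*.coeff-+ (monomial (a i) i) (sumOfMonomials a l) k)
  (trans (cong₂ ℤ._+_ (coeff-monomial-≢ (a i) (All.lookup i∉l k∈l ∘ sym))
                      (coeff-sum-∈ a l! k∈l))
         (ℤₚ.+-identityˡ (a k)))

∈-range⁻ : ∀ {m n i} → m ≤ n → i ∈ range m n → m ≤ i × i ≤ n
∈-range⁻ {m} {n} m≤n i∈ with d , d∈ , refl ← ∈-map⁻ (_+_ m) i∈ =
  m≤m+n m d , s≤s⁻¹ (subst (m + d <_) (m+[n∸m]≡n (m≤n⇒m≤1+n m≤n)) (+-monoʳ-< m (∈-upTo⁻ d∈)))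

∈-range⁺ : ∀ {m n i} → m ≤ i → i ≤ n → i ∈ range m n
∈-range⁺ {m} {n} {i} m≤i i≤n = subst (_∈ range m n) (m+[n∸m]≡n m≤i)
  (∈-map⁺ (_+_ m) (∈-upTo⁺ (∸-monoˡ-< (s≤s i≤n) m≤i)))

range-unique : ∀ m n → Unique (range m n)
range-unique m n = Unique.map⁺ (+-cancelˡ-≡ m _ _) (Unique.upTo⁺ (suc n ∸ m))

module _ (p u n m : ℕ) (m≤n : m ≤ n) (a : ℕ → ℤ) where

  private
    tail = sumOfMonomials a (range m n)

  coeff-poly-zero : m ≥ 1 → coeff (poly p u n m a) 0 ≡ + (p ^ u)
  coeff-poly-zero m≥1 = trans (ℤ*.coeff-+ tail (constant (+ (p ^ u))) 0)
    (cong (ℤ._+ + (p ^ u)) (coeff-sum-∉ a (λ 0∈ → <⇒≱ m≥1 (proj₁ (∈-range⁻ m≤n 0∈)))))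

  coeff-poly-suc : ∀ k → coeff (poly p u n m a) (suc k) ≡ coeff tail (suc k)
  coeff-poly-suc k = trans (ℤ*.coeff-+ tail (constant (+ (p ^ u))) (suc k)) (ℤₚ.+-identityʳ _)

  coeff-poly-range : ∀ {k} → m ≥ 1 → m ≤ k → k ≤ n → coeff (poly p u n m a) k ≡ a k
  coeff-poly-range {zero}  m≥1 m≤k k≤n = contradiction m≤k (<⇒≱ m≥1)
  coeff-poly-range {suc k} m≥1 m≤k k≤n =
    trans (coeff-poly-suc k) (coeff-sum-∈ a (range-unique m n) (∈-range⁺ m≤k k≤n))

  coeff-poly-outside : ∀ {k} → k ≥ 1 → (m ≤ k → k ≤ n → ⊥) → coeff (poly p u n m a) k ≡ 0ℤ
  coeff-poly-outside {suc k} _ out = trans (coeff-poly-suc k)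
    (coeff-sum-∉ a (λ k∈ → let m≤k , k≤n = ∈-range⁻ m≤n k∈ in out m≤k k≤n))

-- Bounding `s j` for i + j = k, rather than at k ∸ i, also covers k < i, where the coefficient is
-- 0.
conv-monomial-≤ : ∀ c i s k M → (∀ j → i + j ≡ k → ∣ s j ∣ ≤ M) →
                  ∣ conv (coeff (monomial c i)) s k ∣ ≤ ∣ c ∣ * M
conv-monomial-≤ c zero    s k       M s≤ = begin
  ∣ conv (coeff (constant c)) s k ∣ ≡⟨ cong ∣_∣ (ℤ*.conv-constant c s k) ⟩
  ∣ c ℤ.* s k ∣                     ≡⟨ ℤₚ.abs-* c (s k) ⟩
  ∣ c ∣ * ∣ s k ∣                   ≤⟨ *-monoʳ-≤ ∣ c ∣ (s≤ k refl) ⟩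
  ∣ c ∣ * M                         ∎
  where open ≤-Reasoning
conv-monomial-≤ c (suc i) s zero    M s≤ = z≤n
conv-monomial-≤ c (suc i) s (suc k) M s≤ = subst (λ z → ∣ z ∣ ≤ ∣ c ∣ * M)
  (sym (ℤₚ.+-identityˡ (conv (coeff (monomial c i)) s k)))
  (conv-monomial-≤ c i s k M (λ j → s≤ j ∘ cong suc))

conv-sum-≤ : ∀ a l s k M → (∀ i j → i ∈ l → i + j ≡ k → ∣ s j ∣ ≤ M) →
             ∣ conv (coeff (sumOfMonomials a l)) s k ∣ ≤ sum (map (λ i → ∣ a i ∣) l) * M
conv-sum-≤ a []      s k M s≤ =
  subst (λ z → ∣ z ∣ ≤ 0) (sym (ℤ*.conv-zeroˡ s (λ _ → refl) k)) z≤n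
conv-sum-≤ a (i ∷ l) s k M s≤ = begin
  ∣ conv (coeff (sumOfMonomials a (i ∷ l))) s k ∣
    ≡⟨ cong ∣_∣ (ℤ*.conv-cong (ℤ*.coeff-+ (monomial (a i) i) _) (λ _ → refl) k) ⟩
  ∣ conv (λ j → coeff (monomial (a i) i) j ℤ.+ coeff (sumOfMonomials a l) j) s k ∣
    ≡⟨ cong ∣_∣ (ℤ*.conv-+ˡ _ _ s k) ⟩
  ∣ conv (coeff (monomial (a i) i)) s k ℤ.+ conv (coeff (sumOfMonomials a l)) s k ∣
    ≤⟨ ℤₚ.∣i+j∣≤∣i∣+∣j∣ (conv (coeff (monomial (a i) i)) s k) _ ⟩
  ∣ conv (coeff (monomial (a i) i)) s k ∣ + ∣ conv (coeff (sumOfMonomials a l)) s k ∣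
    ≤⟨ +-mono-≤ (conv-monomial-≤ (a i) i s k M (λ j → s≤ i j (here refl)))
                (conv-sum-≤ a l s k M (λ i′ j → s≤ i′ j ∘ there)) ⟩
  ∣ a i ∣ * M + sum (map (λ i → ∣ a i ∣) l) * M
    ≡⟨ *-distribʳ-+ M ∣ a i ∣ _ ⟨
  sum (map (λ i → ∣ a i ∣) (i ∷ l)) * M ∎
  where open ≤-Reasoning

-- Contracting integer sequences

module _ (s : ℕ → ℤ) {S P : ℕ} (S<P : S < P) (n K : ℕ)
  (contracting : ∀ k M → K ≤ k → (∀ j → j < k → k ≤ n + j → ∣ s j ∣ ≤ M) → P * ∣ s k ∣ ≤ S * M)
  where

  private
    instance
      P≢0 : NonZero P
      P≢0 = >-nonZero (≤-<-trans z≤n S<P)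

    prefix-bounded : ∀ L → ∃ λ M → ∀ j → j < L → ∣ s j ∣ ≤ M
    prefix-bounded zero    = 0 , λ _ ()
    prefix-bounded (suc L) with M , s≤M ← prefix-bounded L = M + ∣ s L ∣ , bound
      where
      bound : ∀ j → j < suc L → ∣ s j ∣ ≤ M + ∣ s L ∣
      bound j (s≤s j≤L) with m≤n⇒m<n∨m≡n j≤L
      ... | inj₁ j<L  = m≤n⇒m≤n+o ∣ s L ∣ (s≤M j j<L)
      ... | inj₂ refl = m≤n+m ∣ s L ∣ M

    -- A bound on the first K entries persists because S < P. The extra `L` makes the strong
    -- induction on k structural.
    bounded : ∃ λ M → ∀ L k → k < L → ∣ s k ∣ ≤ M
    bounded with M , s≤M ← prefix-bounded K = M , bound
      where
      bound : ∀ L k → k < L → ∣ s k ∣ ≤ M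
      bound (suc L) k (s≤s k≤L) with k <? K
      ... | yes k<K = s≤M k k<K
      ... | no  k≮K = *-cancelˡ-≤ P (≤-trans
        (contracting k M (≮⇒≥ k≮K) (λ j j<k _ → bound L j (<-≤-trans j<k k≤L)))
        (*-monoˡ-≤ M (<⇒≤ S<P)))

    -- Contraction pushes the entries strictly below a positive bound; for integers this lowers the
    -- bound by 1, so finitely many rounds reach 0.
    descend : ∀ M → (∃ λ K′ → ∀ k → K′ ≤ k → ∣ s k ∣ ≤ M) → ∃ λ K′ → ∀ k → K′ ≤ k → ∣ s k ∣ ≤ 0
    descend zero    small         = small
    -- From K + (n + K′) on, `contracting` applies and its window k ≤ n + j lies beyond K′.
    descend (suc M) (K′ , s≤1+M) = descend M (K + (n + K′) , λ k le → s≤s⁻¹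
      (*-cancelˡ-< P ∣ s k ∣ (suc M) (≤-<-trans
        (contracting k (suc M) (m+n≤o⇒m≤o K le) λ j _ k≤n+j → s≤1+M j
          (+-cancelˡ-≤ n K′ j (≤-trans (m+n≤o⇒n≤o K le) k≤n+j)))
        (*-monoˡ-< (suc M) S<P))))

  contracting⇒eventually-zero : ∃ λ K′ → ∀ k → K′ ≤ k → s k ≡ 0ℤ
  contracting⇒eventually-zero
    with M , s≤M ← bounded
    with K′ , s≤0 ← descend M (0 , λ k _ → s≤M (suc k) k ≤-refl)
    = K′ , λ k K′≤k → ℤₚ.∣i∣≡0⇒i≡0 (n≤0⇒n≡0 (s≤0 k K′≤k))

-- Long division of power series by a series t with constant term ε = ±1.
quot : ℤ → (ℕ → ℤ) → (ℕ → ℤ) → ℕ → ℤ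
quot ε t r zero    = ε ℤ.* r 0
quot ε t r (suc k) = quot ε t (λ j → r (suc j) ℤ.- ε ℤ.* r 0 ℤ.* t (suc j)) k

-- The digit ε r(0) reproduces r(0) since ε t(0) = 1; the rest of its multiple of t is what `quot`
-- subtracts before recursing.
conv-quot : ∀ ε t → ε ℤ.* t 0 ≡ 1ℤ → ∀ r k → conv (quot ε t r) t k ≡ r k
conv-quot ε t εt₀ r zero    = begin
  ε ℤ.* r 0 ℤ.* t 0   ≡⟨ cong (ℤ._* t 0) (ℤₚ.*-comm ε (r 0)) ⟩
  r 0 ℤ.* ε ℤ.* t 0   ≡⟨ ℤₚ.*-assoc (r 0) ε (t 0) ⟩
  r 0 ℤ.* (ε ℤ.* t 0) ≡⟨ cong (r 0 ℤ.*_) εt₀ ⟩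
  r 0 ℤ.* 1ℤ          ≡⟨ ℤₚ.*-identityʳ (r 0) ⟩
  r 0                 ∎
  where open ≡-Reasoning
conv-quot ε t εt₀ r (suc k) = begin
  c ℤ.+ conv (quot ε t (λ j → r (suc j) ℤ.- ε ℤ.* r 0 ℤ.* t (suc j))) t k
    ≡⟨ cong (λ z → c ℤ.+ z) (conv-quot ε t εt₀ _ k) ⟩
  c ℤ.+ (r (suc k) ℤ.- c) ≡⟨ cong (λ z → c ℤ.+ z) (ℤₚ.+-comm (r (suc k)) (ℤ.- c)) ⟩
  c ℤ.+ (ℤ.- c ℤ.+ r (suc k)) ≡⟨ ℤₚ.+-assoc c (ℤ.- c) (r (suc k)) ⟨
  c ℤ.- c ℤ.+ r (suc k)   ≡⟨ cong (ℤ._+ r (suc k)) (ℤₚ.+-inverseʳ c) ⟩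
  0ℤ ℤ.+ r (suc k)        ≡⟨ ℤₚ.+-identityˡ (r (suc k)) ⟩
  r (suc k) ∎
  where
  open ≡-Reasoning
  c = ε ℤ.* r 0 ℤ.* t (suc k)

coeff-≥length : ∀ f k → length f ≤ k → coeff f k ≡ 0ℤ
coeff-≥length []      k       _         = refl
coeff-≥length (a ∷ f) (suc k) (s≤s f≤k) = coeff-≥length f k f≤k

coeff-applyUpTo : ∀ (s : ℕ → ℤ) L → (∀ k → L ≤ k → s k ≡ 0ℤ) →
                  ∀ k → coeff (applyUpTo s L) k ≡ s k
coeff-applyUpTo s zero    s≡0 k       = sym (s≡0 k z≤n)
coeff-applyUpTo s (suc L) s≡0 zero    = refl
coeff-applyUpTo s (suc L) s≡0 (suc k) =
  coeff-applyUpTo (s ∘ suc) L (λ k L≤k → s≡0 (suc k) (s≤s L≤k)) k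

∣i∣≡1⇒i*i≡1 : ∀ i → ∣ i ∣ ≡ 1 → i ℤ.* i ≡ 1ℤ
∣i∣≡1⇒i*i≡1 (+ 1)      refl = refl
∣i∣≡1⇒i*i≡1 ℤ.-[1+ 0 ] refl = refl

Unit : Poly → Set
Unit h = ∃ λ s → ∀ k → conv (coeff s) (coeff h) k ≡ coeff (constant 1ℤ) k

-- With s = 1/h, f s = g has zero coefficients from `length g` on. There pᵘ s(k) is minus a
-- combination of earlier s(j) with weights aᵢ, so s contracts and is a polynomial.
dominant⇒unit : ∀ p u n m → m ≤ n → m ≥ 1 → ∀ a →
  p ^ u > sum (map (λ i → ∣ a i ∣) (range m n)) →
  ∀ g h → (∀ k → conv (coeff g) (coeff h) k ≡ coeff (poly p u n m a) k) →
  ∣ coeff h 0 ∣ ≡ 1 → Unit h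
dominant⇒unit p u n m m≤n m≥1 a dominant g h gh≡f ∣h₀∣≡1 =
  let K′ , s≡0 = contracting⇒eventually-zero s dominant n (length g) contracting
  in applyUpTo s K′ , λ k →
      trans (ℤ*.conv-cong (coeff-applyUpTo s K′ s≡0) (λ _ → refl) k) (sh≡1 k)
  where
  s : ℕ → ℤ
  -- The constant term of h, being ±1, is its own inverse.
  s = quot (coeff h 0) (coeff h) (coeff (constant 1ℤ))

  tail : Poly
  tail = sumOfMonomials a (range m n)

  sh≡1 : ∀ k → conv s (coeff h) k ≡ coeff (constant 1ℤ) k
  sh≡1 = conv-quot (coeff h 0) (coeff h) (∣i∣≡1⇒i*i≡1 (coeff h 0) ∣h₀∣≡1) _

  fs≡g : ∀ k → conv (coeff tail) s k ℤ.+ + (p ^ u) ℤ.* s k ≡ coeff g k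
  fs≡g k = begin
    conv (coeff tail) s k ℤ.+ + (p ^ u) ℤ.* s k
      ≡⟨ cong (λ z → conv (coeff tail) s k ℤ.+ z) (ℤ*.conv-constant (+ (p ^ u)) s k) ⟨
    conv (coeff tail) s k ℤ.+ conv (coeff (constant (+ (p ^ u)))) s k
      ≡⟨ ℤ*.conv-+ˡ _ _ s k ⟨
    conv (λ j → coeff tail j ℤ.+ coeff (constant (+ (p ^ u))) j) s k
      ≡⟨ ℤ*.conv-cong (λ j → trans (sym (ℤ*.coeff-+ tail _ j)) (sym (gh≡f j))) (λ _ → refl) k ⟩
    conv (conv (coeff g) (coeff h)) s k
      ≡⟨ ℤ*.conv-assoc (coeff g) (coeff h) s k ⟩
    conv (coeff g) (conv (coeff h) s) k
      ≡⟨ ℤ*.conv-cong (λ _ → refl) (λ j → trans (ℤ*.conv-comm (coeff h) s j) (sh≡1 j)) k ⟩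
    conv (coeff g) (coeff (constant 1ℤ)) k
      ≡⟨ ℤ*.conv-identityʳ (coeff g) k ⟩
    coeff g k ∎
    where open ≡-Reasoning

  contracting : ∀ k M → length g ≤ k → (∀ j → j < k → k ≤ n + j → ∣ s j ∣ ≤ M) →
                p ^ u * ∣ s k ∣ ≤ sum (map (λ i → ∣ a i ∣) (range m n)) * M
  contracting k M len≤k s≤M = begin
    p ^ u * ∣ s k ∣             ≡⟨ ℤₚ.abs-* (+ (p ^ u)) (s k) ⟨
    ∣ + (p ^ u) ℤ.* s k ∣       ≡⟨ ℤₚ.∣-i∣≡∣i∣ (+ (p ^ u) ℤ.* s k) ⟨
    ∣ ℤ.- (+ (p ^ u) ℤ.* s k) ∣ ≡⟨ cong ∣_∣ tail-part ⟨
    ∣ conv (coeff tail) s k ∣   ≤⟨ conv-sum-≤ a (range m n) s k M earlier ⟩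
    sum (map (λ i → ∣ a i ∣) (range m n)) * M ∎
    where
    open ≤-Reasoning
    tail-part : conv (coeff tail) s k ≡ ℤ.- (+ (p ^ u) ℤ.* s k)
    tail-part = AbelianGroupProperties.inverseˡ-unique ℤₚ.+-0-abelianGroup
      (conv (coeff tail) s k) (+ (p ^ u) ℤ.* s k)
      (trans (fs≡g k) (coeff-≥length g k len≤k))
    earlier : ∀ i j → i ∈ range m n → i + j ≡ k → ∣ s j ∣ ≤ M
    earlier i j i∈ refl with ∈-range⁻ m≤n i∈
    -- i ≥ m ≥ 1 places j before k, and i ≤ n places it within distance n.
    ... | m≤i , i≤n = s≤M j (+-monoˡ-≤ j (≤-trans m≥1 m≤i)) (+-monoˡ-≤ j i≤n)

-- Passage from ℚ[x] to ℤ[x]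

φ : ℤ → ℚ
φ i = i ℚ./ 1

toℚᵘ-φ : ∀ i → toℚᵘ (φ i) ℚᵘ.≃ mkℚᵘ i 0
toℚᵘ-φ i = ℚₚ.toℚᵘ-fromℚᵘ (mkℚᵘ i 0)

φ-injective : ∀ {i j} → φ i ≡ φ j → i ≡ j
φ-injective {i} {j} eq with ℚₚ./-injective-≃ (mkℚᵘ i 0) (mkℚᵘ j 0) eq
... | *≡* i*1≡j*1 = ℤₚ.*-cancelʳ-≡ i j 1ℤ i*1≡j*1

φ-+ : ∀ i j → φ (i ℤ.+ j) ≡ φ i ℚ.+ φ j
φ-+ i j = ℚₚ.toℚᵘ-injective $ begin
  toℚᵘ (φ (i ℤ.+ j))            ≈⟨ toℚᵘ-φ (i ℤ.+ j) ⟩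
  mkℚᵘ (i ℤ.+ j) 0
    ≈⟨ *≡* (cong (ℤ._* 1ℤ) (sym (cong₂ ℤ._+_ (ℤₚ.*-identityʳ i) (ℤₚ.*-identityʳ j)))) ⟩
  mkℚᵘ i 0 ℚᵘ.+ mkℚᵘ j 0        ≈⟨ ℚᵘₚ.+-cong (toℚᵘ-φ i) (toℚᵘ-φ j) ⟨
  toℚᵘ (φ i) ℚᵘ.+ toℚᵘ (φ j)    ≈⟨ ℚₚ.toℚᵘ-homo-+ (φ i) (φ j) ⟨
  toℚᵘ (φ i ℚ.+ φ j)            ∎
  where open ℚᵘₚ.≃-Reasoning

φ-* : ∀ i j → φ (i ℤ.* j) ≡ φ i ℚ.* φ j
φ-* i j = ℚₚ.toℚᵘ-injective $ begin
  toℚᵘ (φ (i ℤ.* j))            ≈⟨ toℚᵘ-φ (i ℤ.* j) ⟩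
  mkℚᵘ i 0 ℚᵘ.* mkℚᵘ j 0        ≈⟨ ℚᵘₚ.*-cong (toℚᵘ-φ i) (toℚᵘ-φ j) ⟨
  toℚᵘ (φ i) ℚᵘ.* toℚᵘ (φ j)    ≈⟨ ℚₚ.toℚᵘ-homo-* (φ i) (φ j) ⟨
  toℚᵘ (φ i ℚ.* φ j)            ∎
  where open ℚᵘₚ.≃-Reasoning

φ-↧ : ∀ q → φ (↧ q) ℚ.* q ≡ φ (↥ q)
φ-↧ q@record{} = ℚₚ.toℚᵘ-injective $ begin
  toℚᵘ (φ (↧ q) ℚ.* q)           ≈⟨ ℚₚ.toℚᵘ-homo-* (φ (↧ q)) q ⟩
  toℚᵘ (φ (↧ q)) ℚᵘ.* toℚᵘ q     ≈⟨ ℚᵘₚ.*-congʳ {toℚᵘ q} (toℚᵘ-φ (↧ q)) ⟩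
  mkℚᵘ (↧ q) 0 ℚᵘ.* toℚᵘ q
    ≈⟨ *≡* (trans (ℤₚ.*-identityʳ _) (trans (ℤₚ.*-comm (↧ q) (↥ q))
             (cong (λ d → ↥ q ℤ.* + d) (sym (+-identityʳ (↧ₙ q)))))) ⟩
  mkℚᵘ (↥ q) 0                   ≈⟨ toℚᵘ-φ (↥ q) ⟨
  toℚᵘ (φ (↥ q))                 ∎
  where open ℚᵘₚ.≃-Reasoning

φ-inverse : ∀ d .{{_ : NonZero d}} → ∃ λ r → φ (+ d) ℚ.* r ≡ 1ℚ
φ-inverse d@(suc _) = 1/ φ (+ d) , ℚₚ.*-inverseʳ (φ (+ d))
  where
  instance
    φd≢0 : ℚ.NonZero (φ (+ d))
    φd≢0 = ℚ.≢-nonZero λ φd≡0 → contradiction (φ-injective {+ d} {0ℤ} φd≡0) λ ()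

-- Separate multipliers for the two factors let it serve both for clearing denominators and for
-- rescaling inverses.
conv-φ : ∀ (c e : ℚ) (x y : ℕ → ℚ) (s t : ℕ → ℤ) →
         (∀ i → c ℚ.* x i ≡ φ (s i)) → (∀ i → e ℚ.* y i ≡ φ (t i)) →
         ∀ k → c ℚ.* e ℚ.* ℚ*.conv x y k ≡ φ (conv s t k)
conv-φ c e x y s t cx≡ ey≡ zero    = trans (ℚ-semigroup.interchange c e (x 0) (y 0))
  (trans (cong₂ ℚ._*_ (cx≡ 0) (ey≡ 0)) (sym (φ-* (s 0) (t 0))))
conv-φ c e x y s t cx≡ ey≡ (suc k) = begin
  c ℚ.* e ℚ.* (x 0 ℚ.* y (suc k) ℚ.+ ℚ*.conv (x ∘ suc) y k)
    ≡⟨ ℚₚ.*-distribˡ-+ (c ℚ.* e) _ _ ⟩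
  c ℚ.* e ℚ.* (x 0 ℚ.* y (suc k)) ℚ.+ c ℚ.* e ℚ.* ℚ*.conv (x ∘ suc) y k
    ≡⟨ cong₂ ℚ._+_ (trans (ℚ-semigroup.interchange c e (x 0) (y (suc k)))
                     (cong₂ ℚ._*_ (cx≡ 0) (ey≡ (suc k))))
                   (conv-φ c e (x ∘ suc) y (s ∘ suc) t (cx≡ ∘ suc) ey≡ k) ⟩
  φ (s 0) ℚ.* φ (t (suc k)) ℚ.+ φ (conv (s ∘ suc) t k)
    ≡⟨ cong (ℚ._+ φ (conv (s ∘ suc) t k)) (φ-* (s 0) (t (suc k))) ⟨
  φ (s 0 ℤ.* t (suc k)) ℚ.+ φ (conv (s ∘ suc) t k)
    ≡⟨ φ-+ (s 0 ℤ.* t (suc k)) (conv (s ∘ suc) t k) ⟨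
  φ (conv s t (suc k)) ∎
  where open ≡-Reasoning

coeff-toℚ[x] : ∀ f i → ℚ[x].coeff (toℚ[x] f) i ≡ φ (coeff f i)
coeff-toℚ[x] []      i       = refl
coeff-toℚ[x] (a ∷ f) zero    = refl
coeff-toℚ[x] (a ∷ f) (suc i) = coeff-toℚ[x] f i

coeff-one : ∀ k → ℚ[x].coeff (ℚ[x].constant 1ℚ) k ≡ φ (coeff (constant 1ℤ) k)
coeff-one zero    = refl
coeff-one (suc k) = refl

-- The product of all denominators serves as a common denominator.
clearDenominators : ∀ x → ∃₂ λ d g → NonZero d × (∀ i → φ (+ d) ℚ.* ℚ[x].coeff x i ≡ φ (coeff g i))
clearDenominators []      = 1 , [] , _ , λ _ → ℚₚ.*-zeroʳ (φ (+ 1))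
clearDenominators (a ∷ x) with d , g , d≢0 , dx≡g ← clearDenominators x =
  ↧ₙ a * d , + d ℤ.* ↥ a ∷ map (↧ a ℤ.*_) g , m*n≢0 (↧ₙ a) d {{_}} {{d≢0}} , λ
    { zero → begin
        φ (+ (↧ₙ a * d)) ℚ.* a             ≡⟨ cong (ℚ._* a) split ⟩
        φ (↧ a) ℚ.* φ (+ d) ℚ.* a          ≡⟨ ℚ-semigroup.xy∙z≈y∙xz (φ (↧ a)) (φ (+ d)) a ⟩
        φ (+ d) ℚ.* (φ (↧ a) ℚ.* a)        ≡⟨ cong (φ (+ d) ℚ.*_) (φ-↧ a) ⟩
        φ (+ d) ℚ.* φ (↥ a)                ≡⟨ φ-* (+ d) (↥ a) ⟨
        φ (+ d ℤ.* ↥ a)                    ∎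
    ; (suc i) → begin
        φ (+ (↧ₙ a * d)) ℚ.* ℚ[x].coeff x i      ≡⟨ cong (ℚ._* ℚ[x].coeff x i) split ⟩
        φ (↧ a) ℚ.* φ (+ d) ℚ.* ℚ[x].coeff x i   ≡⟨ ℚₚ.*-assoc (φ (↧ a)) (φ (+ d)) (ℚ[x].coeff x i) ⟩
        φ (↧ a) ℚ.* (φ (+ d) ℚ.* ℚ[x].coeff x i) ≡⟨ cong (φ (↧ a) ℚ.*_) (dx≡g i) ⟩
        φ (↧ a) ℚ.* φ (coeff g i)                ≡⟨ φ-* (↧ a) (coeff g i) ⟨
        φ (↧ a ℤ.* coeff g i)                    ≡⟨ cong φ (ℤ*.coeff-map-* (↧ a) g i) ⟨
        φ (coeff (map (↧ a ℤ.*_) g) i)           ∎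
    }
  where
  open ≡-Reasoning
  split : φ (+ (↧ₙ a * d)) ≡ φ (↧ a) ℚ.* φ (+ d)
  split = trans (cong φ (ℤₚ.pos-* (↧ₙ a) d)) (φ-* (↧ a) (+ d))

-- From c x = g and s g = 1, the polynomial c s is inverse to x.
unit⇒∣1 : ∀ {c c′ x g} → c ℚ.* c′ ≡ 1ℚ → (∀ i → c ℚ.* ℚ[x].coeff x i ≡ φ (coeff g i)) →
          Unit g → x ∣ₓ ℚ[x].constant 1ℚ
unit⇒∣1 {c} {c′} {x} {g} cc′≡1 cx≡g (s , sg≡1) = t ∣ʳ, λ k → begin
  ℚ[x].coeff (t ℚ[x].*ₚ x) k                                   ≡⟨ ℚ*.coeff-* t x k ⟩
  ℚ*.conv (ℚ[x].coeff t) (ℚ[x].coeff x) k                      ≡⟨ ℚₚ.*-identityˡ _ ⟨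
  1ℚ ℚ.* ℚ*.conv (ℚ[x].coeff t) (ℚ[x].coeff x) k
    ≡⟨ cong (ℚ._* ℚ*.conv (ℚ[x].coeff t) (ℚ[x].coeff x) k) c′c≡1 ⟨
  c′ ℚ.* c ℚ.* ℚ*.conv (ℚ[x].coeff t) (ℚ[x].coeff x) k
    ≡⟨ conv-φ c′ c (ℚ[x].coeff t) (ℚ[x].coeff x) (coeff s) (coeff g) c′t≡s cx≡g k ⟩
  φ (conv (coeff s) (coeff g) k)                               ≡⟨ cong φ (sg≡1 k) ⟩
  φ (coeff (constant 1ℤ) k)                                    ≡⟨ coeff-one k ⟨
  ℚ[x].coeff (ℚ[x].constant 1ℚ) k                              ∎
  where
  open ≡-Reasoning
  t = map (c ℚ.*_) (toℚ[x] s)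
  c′c≡1 = trans (ℚₚ.*-comm c′ c) cc′≡1
  c′t≡s : ∀ i → c′ ℚ.* ℚ[x].coeff t i ≡ φ (coeff s i)
  c′t≡s i = begin
    c′ ℚ.* ℚ[x].coeff t i                     ≡⟨ cong (c′ ℚ.*_) (ℚ*.coeff-map-* c (toℚ[x] s) i) ⟩
    c′ ℚ.* (c ℚ.* ℚ[x].coeff (toℚ[x] s) i)    ≡⟨ ℚₚ.*-assoc c′ c _ ⟨
    c′ ℚ.* c ℚ.* ℚ[x].coeff (toℚ[x] s) i      ≡⟨ cong (ℚ._* ℚ[x].coeff (toℚ[x] s) i) c′c≡1 ⟩
    1ℚ ℚ.* ℚ[x].coeff (toℚ[x] s) i            ≡⟨ ℚₚ.*-identityˡ _ ⟩
    ℚ[x].coeff (toℚ[x] s) i                   ≡⟨ coeff-toℚ[x] s i ⟩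
    φ (coeff s i)                             ∎

-- The factor `d` collects cancelled primes; it is a unit of ℚ, so invertibility over ℚ is
-- unaffected.
Multiple : Poly → Poly → Set
Multiple g g′ = ∃ λ d → NonZero d × (∀ i → coeff g i ≡ + d ℤ.* coeff g′ i)

multiple-refl : ∀ g → Multiple g g
multiple-refl g = 1 , _ , λ i → sym (ℤₚ.*-identityˡ (coeff g i))

multiple-trans : ∀ q .{{q≢0 : NonZero q}} g g₁ {g′} → (∀ i → coeff g i ≡ + q ℤ.* coeff g₁ i) →
                 Multiple g₁ g′ → Multiple g g′
multiple-trans q {{q≢0}} g g₁ {g′} g≡qg₁ (d , d≢0 , g₁≡dg′) =
  q * d , m*n≢0 q d {{q≢0}} {{d≢0}} , λ i →
  trans (g≡qg₁ i) (trans (cong (+ q ℤ.*_) (g₁≡dg′ i))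
    (trans (sym (ℤₚ.*-assoc (+ q) (+ d) (coeff g′ i)))
      (cong (ℤ._* coeff g′ i) (sym (ℤₚ.pos-* q d)))))

-- Each prime in `qs` divides all coefficients of g h; by Gauss' lemma it divides one whole factor
-- and is cancelled there.
integralFactors : ∀ {qs} → All Prime qs → ∀ g h (F : ℕ → ℤ) →
  (∀ k → conv (coeff g) (coeff h) k ≡ + product qs ℤ.* F k) →
  ∃₂ λ g′ h′ → Multiple g g′ × Multiple h h′ × (∀ k → conv (coeff g′) (coeff h′) k ≡ F k)
integralFactors [] g h F gh≡ =
  g , h , multiple-refl g , multiple-refl h , λ k → trans (gh≡ k) (ℤₚ.*-identityˡ (F k))
integralFactors {q ∷ qs} (q-prime ∷ primes) g h F gh≡ =
  [ (λ q∣g → let g₁ , g≡ = divideBy q g q∣g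
                 g′ , h′ , gg′ , hh′ , eq = integralFactors primes g₁ h F λ k →
                   cancel (trans (sym (ℤ*.conv-*ˡ (+ q) (coeff g₁) (coeff h) k))
                     (trans (sym (ℤ*.conv-cong g≡ (λ _ → refl) k)) (gh≡q k)))
             in g′ , h′ , multiple-trans q g g₁ {g′} g≡ gg′ , hh′ , eq)
  , (λ q∣h → let h₁ , h≡ = divideBy q h q∣h
                 g′ , h′ , gg′ , hh′ , eq = integralFactors primes g h₁ F λ k →
                   cancel (trans (cong (+ q ℤ.*_) (ℤ*.conv-comm (coeff g) (coeff h₁) k))
                     (trans (sym (ℤ*.conv-*ˡ (+ q) (coeff h₁) (coeff g) k))
                     (trans (sym (ℤ*.conv-cong h≡ (λ _ → refl) k))
                     (trans (ℤ*.conv-comm (coeff h) (coeff g) k) (gh≡q k)))))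
             in g′ , h′ , gg′ , multiple-trans q h h₁ {h′} h≡ hh′ , eq)
  ]′ (gauss q-prime g h λ k → subst (λ z → + q ∣ z) (sym (gh≡q k))
       (subst (q ℕ∣.∣_) (sym (ℤₚ.abs-* (+ q) (+ product qs ℤ.* F k))) (ℕ∣.m∣m*n _)))
  where
  instance
    q≢0 : NonZero q
    q≢0 = prime⇒nonZero q-prime
  gh≡q : ∀ k → conv (coeff g) (coeff h) k ≡ + q ℤ.* (+ product qs ℤ.* F k)
  gh≡q k = trans (gh≡ k) (trans (cong (ℤ._* F k) (ℤₚ.pos-* q (product qs)))
    (ℤₚ.*-assoc (+ q) (+ product qs) (F k)))
  cancel : ∀ {y z} → + q ℤ.* y ≡ + q ℤ.* z → y ≡ z
  cancel {y} {z} = ℤₚ.*-cancelˡ-≡ (+ q) y z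

-- Leading coefficients and non-units

leading : ∀ f → (∀ i → coeff f i ≡ 0ℤ) ⊎
          (∃ λ d → coeff f d ≢ 0ℤ × (∀ i → d < i → coeff f i ≡ 0ℤ))
leading []      = inj₁ λ _ → refl
leading (a ∷ f) with leading f
... | inj₂ (d , f_d≢0 , above) = inj₂ (suc d , f_d≢0 , λ { (suc i) (s≤s d<i) → above i d<i })
... | inj₁ f≡0 with a ℤₚ.≟ 0ℤ
...   | yes a≡0 = inj₁ λ { zero → a≡0 ; (suc i) → f≡0 i }
...   | no  a≢0 = inj₂ (0 , a≢0 , λ { (suc i) _ → f≡0 i })

-- The case N = 0 of conv-∤, since 0 ∣ z means z ≡ 0.
conv-leading-≢0 : ∀ g h d n → coeff g d ≢ 0ℤ → coeff h n ≢ 0ℤ →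
  (∀ i → d < i → coeff g i ≡ 0ℤ) → (∀ i → n < i → coeff h i ≡ 0ℤ) →
  conv (coeff g) (coeff h) (d + n) ≢ 0ℤ
conv-leading-≢0 g h d n g_d≢0 h_n≢0 above-d above-n conv≡0 =
  conv-∤ 0 (coeff g) (coeff h) d n
    (λ 0∣ → [ g_d≢0 , h_n≢0 ]′ (ℤₚ.i*j≡0⇒i≡0∨j≡0 (coeff g d) (ℤₚ.∣i∣≡0⇒i≡0 (ℕ∣.0∣⇒≡0 0∣))))
    (λ i j eq i≢d → subst (λ z → + 0 ∣ z) (sym (vanishing i j eq i≢d)) ℕ∣.∣-refl)
    (subst (λ z → + 0 ∣ z) (sym conv≡0) ℕ∣.∣-refl)
  where
  vanishing : ∀ i j → i + j ≡ d + n → i ≢ d → coeff g i ℤ.* coeff h j ≡ 0ℤ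
  vanishing i j eq i≢d with <-cmp i d
  ... | tri< i<d _ _ = trans (cong (coeff g i ℤ.*_) (above-n j
          (+-cancelˡ-< d n j (subst (_< d + j) eq (+-monoˡ-< j i<d)))))
          (ℤₚ.*-zeroʳ (coeff g i))
  ... | tri≈ _ i≡d _ = contradiction i≡d i≢d
  ... | tri> _ _ d<i = trans (cong (ℤ._* coeff h j) (above-d i d<i)) (ℤₚ.*-zeroˡ (coeff h j))

-- Clearing denominators in t f = 1 gives g f = d over ℤ with d ≠ 0. Then g ≠ 0, and g f has a
-- nonzero coefficient in degree at least n ≥ 1.
toℚ[x]-∤1 : ∀ f n → n ≥ 1 → coeff f n ≢ 0ℤ → (∀ i → n < i → coeff f i ≡ 0ℤ) →
     ¬ (toℚ[x] f ∣ₓ ℚ[x].constant 1ℚ)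
toℚ[x]-∤1 f n n≥1 f_n≢0 above-n (t ∣ʳ, tf≡1)
  with d , g , d≢0 , dt≡g ← clearDenominators t
  = contra (leading g)
  where
  open ≡-Reasoning
  gf≡d : ∀ k → conv (coeff g) (coeff f) k ≡ + d ℤ.* coeff (constant 1ℤ) k
  gf≡d k = φ-injective $ begin
    φ (conv (coeff g) (coeff f) k)
      ≡⟨ conv-φ (φ (+ d)) 1ℚ _ _ (coeff g) (coeff f) dt≡g
           (λ i → trans (ℚₚ.*-identityˡ _) (coeff-toℚ[x] f i)) k ⟨
    φ (+ d) ℚ.* 1ℚ ℚ.* ℚ*.conv (ℚ[x].coeff t) (ℚ[x].coeff (toℚ[x] f)) k
      ≡⟨ cong₂ ℚ._*_ (ℚₚ.*-identityʳ (φ (+ d))) (sym (ℚ*.coeff-* t (toℚ[x] f) k)) ⟩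
    φ (+ d) ℚ.* ℚ[x].coeff (t ℚ[x].*ₚ toℚ[x] f) k
      ≡⟨ cong (φ (+ d) ℚ.*_) (trans (tf≡1 k) (coeff-one k)) ⟩
    φ (+ d) ℚ.* φ (coeff (constant 1ℤ) k)
      ≡⟨ φ-* (+ d) (coeff (constant 1ℤ) k) ⟨
    φ (+ d ℤ.* coeff (constant 1ℤ) k) ∎

  positive-degree : ∀ e → coeff (constant 1ℤ) (e + n) ≡ 0ℤ
  positive-degree e with e + n in e+n≡
  ... | zero  = contradiction (m+n≡0⇒n≡0 e e+n≡) (m<n⇒n≢0 n≥1)
  ... | suc _ = refl

  contra : _ → ⊥
  contra (inj₁ g≡0) = ≢-nonZero⁻¹ d {{d≢0}} (ℤₚ.+-injective (begin
    + d                              ≡⟨ ℤₚ.*-identityʳ (+ d) ⟨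
    + d ℤ.* 1ℤ                       ≡⟨ gf≡d 0 ⟨
    coeff g 0 ℤ.* coeff f 0          ≡⟨ cong (ℤ._* coeff f 0) (g≡0 0) ⟩
    0ℤ                               ∎))
  contra (inj₂ (e , g_e≢0 , above-e)) =
    conv-leading-≢0 g f e n g_e≢0 f_n≢0 above-e above-n (begin
      conv (coeff g) (coeff f) (e + n)         ≡⟨ gf≡d (e + n) ⟩
      + d ℤ.* coeff (constant 1ℤ) (e + n)      ≡⟨ cong (+ d ℤ.*_) (positive-degree e) ⟩
      + d ℤ.* 0ℤ                               ≡⟨ ℤₚ.*-zeroʳ (+ d) ⟩
      0ℤ                                       ∎)

-- Clearing denominators gives G H = d e f, and the primes of d e are then cancelled. As g and h are
-- nonzero rational multiples of x and y, inverses carry over.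
factorOverℤ : ∀ f x y → toℚ[x] f ℚ[x].≈ₚ x ℚ[x].*ₚ y →
  ∃₂ λ g h → (∀ k → conv (coeff g) (coeff h) k ≡ coeff f k) ×
    (Unit g → x ∣ₓ ℚ[x].constant 1ℚ) ×
    (Unit h → y ∣ₓ ℚ[x].constant 1ℚ)
factorOverℤ f x y f≡xy
  with d , G , d≢0 , dx≡G ← clearDenominators x
     | e , H , e≢0 , ey≡H ← clearDenominators y
  = let g , h , Gg , Hh , gh≡f = integralFactors (factorsPrime de-factors) G H (coeff f) GH≡
    in g , h , gh≡f , transfer x G g d d≢0 dx≡G Gg , transfer y H h e e≢0 ey≡H Hh
  where
  open ≡-Reasoning
  open PrimeFactorisation
  de-factors = factorise (d * e) {{m*n≢0 d e {{d≢0}} {{e≢0}}}}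

  GH≡ : ∀ k → conv (coeff G) (coeff H) k ≡ + product (factors de-factors) ℤ.* coeff f k
  GH≡ k = φ-injective $ begin
    φ (conv (coeff G) (coeff H) k)
      ≡⟨ conv-φ (φ (+ d)) (φ (+ e)) _ _ (coeff G) (coeff H) dx≡G ey≡H k ⟨
    φ (+ d) ℚ.* φ (+ e) ℚ.* ℚ*.conv (ℚ[x].coeff x) (ℚ[x].coeff y) k
      ≡⟨ cong₂ ℚ._*_ (sym (trans (cong φ (ℤₚ.pos-* d e)) (φ-* (+ d) (+ e))))
           (trans (sym (ℚ*.coeff-* x y k)) (trans (sym (f≡xy k)) (coeff-toℚ[x] f k))) ⟩
    φ (+ (d * e)) ℚ.* φ (coeff f k)
      ≡⟨ φ-* (+ (d * e)) (coeff f k) ⟨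
    φ (+ (d * e) ℤ.* coeff f k)
      ≡⟨ cong (λ N → φ (+ N ℤ.* coeff f k)) (isFactorisation de-factors) ⟩
    φ (+ product (factors de-factors) ℤ.* coeff f k) ∎

  transfer : ∀ x G g d → NonZero d → (∀ i → φ (+ d) ℚ.* ℚ[x].coeff x i ≡ φ (coeff G i)) →
             Multiple G g → Unit g → x ∣ₓ ℚ[x].constant 1ℚ
  transfer x G g d d≢0 dx≡G (e , e≢0 , G≡eg)
    with d′ , dd′≡1 ← φ-inverse d {{d≢0}} | e′ , ee′≡1 ← φ-inverse e {{e≢0}}
    = let e′e≡1 = trans (ℚₚ.*-comm e′ (φ (+ e))) ee′≡1 in
      -- From d x = G = e g, the scalar with c x = g is d/e, and its inverse is e/d.
      unit⇒∣1 {c = e′ ℚ.* φ (+ d)} {c′ = φ (+ e) ℚ.* d′} {g = g}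
        (begin
          e′ ℚ.* φ (+ d) ℚ.* (φ (+ e) ℚ.* d′) ≡⟨ ℚ-semigroup.interchange e′ (φ (+ d)) (φ (+ e)) d′ ⟩
          e′ ℚ.* φ (+ e) ℚ.* (φ (+ d) ℚ.* d′) ≡⟨ cong₂ ℚ._*_ e′e≡1 dd′≡1 ⟩
          1ℚ ℚ.* 1ℚ                           ≡⟨ ℚₚ.*-identityˡ 1ℚ ⟩
          1ℚ                                  ∎)
        (λ i → begin
          e′ ℚ.* φ (+ d) ℚ.* ℚ[x].coeff x i   ≡⟨ ℚₚ.*-assoc e′ (φ (+ d)) (ℚ[x].coeff x i) ⟩
          e′ ℚ.* (φ (+ d) ℚ.* ℚ[x].coeff x i) ≡⟨ cong (e′ ℚ.*_) (trans (dx≡G i) (cong φ (G≡eg i))) ⟩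
          e′ ℚ.* φ (+ e ℤ.* coeff g i)        ≡⟨ cong (e′ ℚ.*_) (φ-* (+ e) (coeff g i)) ⟩
          e′ ℚ.* (φ (+ e) ℚ.* φ (coeff g i))  ≡⟨ ℚₚ.*-assoc e′ (φ (+ e)) (φ (coeff g i)) ⟨
          e′ ℚ.* φ (+ e) ℚ.* φ (coeff g i)    ≡⟨ cong (ℚ._* φ (coeff g i)) e′e≡1 ⟩
          1ℚ ℚ.* φ (coeff g i)                ≡⟨ ℚₚ.*-identityˡ (φ (coeff g i)) ⟩
          φ (coeff g i)                       ∎)

-- Irreducibility of f

module _ (p u n m : ℕ) (p-prime : Prime p) (m≤n : m ≤ n) (m≥1 : m ≥ 1) (a : ℕ → ℤ) where

  private
    f : Poly
    f = poly p u n m a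

  -- The Newton diagram of f lies on or above the line through (0, u) and (m, 0): the coefficients
  -- strictly between 0 and m vanish, and from m on the index alone contributes u k ≥ m u.
  poly-weights : ∀ k → HasWeight p m u (coeff f) (m * u) k
  poly-weights zero = u
    , subst (λ z → + (p ^ u) ∣ z) (sym (coeff-poly-zero p u n m m≤n a m≥1)) ℕ∣.∣-refl
    , m≤m+n (m * u) (u * 0)
  poly-weights k@(suc _) with m ≤? k
  ... | yes m≤k = 0 , ℕ∣.1∣ _
    , ≤-trans (subst (_≤ u * k) (*-comm u m) (*-monoʳ-≤ u m≤k)) (m≤n+m (u * k) (m * 0))
  ... | no  m≰k = u
    , subst (λ z → + (p ^ u) ∣ z)
        (sym (coeff-poly-outside p u n m m≤n a (s≤s z≤n) (λ m≤k _ → m≰k m≤k))) ((p ^ u) ℕ∣.∣0)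
    , m≤m+n (m * u) (u * k)

  irreducibleOverℤ : ¬ (+ p ∣ a m) → gcd u m ≡ 1 →
    p ^ u > sum (map (λ i → ∣ a i ∣) (range m n)) →
    ∀ g h → (∀ k → conv (coeff g) (coeff h) k ≡ coeff f k) → Unit g ⊎ Unit h
  irreducibleOverℤ p∤aₘ gcd≡1 dominant g h gh≡f
    with m*n≡p^u⇒powers p-prime u ∣ coeff g 0 ∣ ∣ coeff h 0 ∣
           (trans (sym (ℤₚ.abs-* (coeff g 0) (coeff h 0)))
             (cong ∣_∣ (trans (gh≡f 0) (coeff-poly-zero p u n m m≤n a m≥1))))
  -- Here g(0) = ±1, so g and h exchange roles.
  ... | zero , _ , g₀ , _ , _ = inj₁ (dominant⇒unit p u n m m≤n m≥1 a dominant h g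
          (λ k → trans (ℤ*.conv-comm (coeff h) (coeff g) k) (gh≡f k)) g₀)
  ... | suc _ , zero , _ , h₀ , _ = inj₂ (dominant⇒unit p u n m m≤n m≥1 a dominant g h gh≡f h₀)
  ... | suc α , suc β , g₀ , h₀ , α+β = ⊥-elim
    (newton-irreducible p-prime u m m≥1 gcd≡1 g h {α} {β} g₀ h₀ α+β
      (λ k → let e , p^e∣ , le = poly-weights k in
             e , subst (λ z → + (p ^ e) ∣ z) (sym (gh≡f k)) p^e∣ , le)
      (p∤aₘ ∘ subst (λ z → + p ∣ z)
        (trans (gh≡f m) (coeff-poly-range p u n m m≤n a m≥1 ≤-refl m≤n))))

theorem1 : (p u n m : ℕ) → Prime p → u ≥ 1 → n ≥ m → m ≥ 1 →
    (a : ℕ → ℤ) → a n ≢ 0ℤ →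
    ¬ (+ p ∣ a m) →
    gcd u m ≡ 1 →
    p ^ u > sum (map (λ i → ∣ a i ∣) (range m n)) →
    IrreducibleOverℚ (poly p u n m a)
theorem1 p u n m p-prime u≥1 m≤n m≥1 a aₙ≢0 p∤aₘ gcd≡1 dominant = RawSemiringDefs.mkIrred
  -- f is no unit: its leading coefficient aₙ ≠ 0 stands in degree n ≥ m ≥ 1.
  (toℚ[x]-∤1 (poly p u n m a) n n≥1
    (aₙ≢0 ∘ trans (sym (coeff-poly-range p u n m m≤n a m≥1 m≤n ≤-refl)))
    (λ i n<i → coeff-poly-outside p u n m m≤n a (≤-trans n≥1 (<⇒≤ n<i)) (λ _ → <⇒≱ n<i)))
  λ {x} {y} f≡xy →
    let g , h , gh≡f , g-unit , h-unit = factorOverℤ (poly p u n m a) x y f≡xy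
    in Sum.map g-unit h-unit
         (irreducibleOverℤ p u n m p-prime m≤n m≥1 a p∤aₘ gcd≡1 dominant g h gh≡f)
  where
  n≥1 : n ≥ 1
  n≥1 = ≤-trans m≥1 m≤n
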